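{- Let $q$ be a prime power and let $M$ be a simple matroid representable over $GF(q)$ that has no coloops and has two distinct loose elements $e$ and $f$. Then $r(M)\le 2q$, or $\{e,f\}$ is a cocircuit of $M$.
   Context: All matroids are finite. An element $t$ of a matroid $M$ is loose if every circuit of $M$ containing $t$ has size at least the rank $r(M)$. -}

module Defs where

open import Algebra.Bundles using (CommutativeRing)
import Algebra.Definitions.RawMonoid as RawMonoidDefs
open import Data.Bool.Base using (if_then_else_)
open import Data.Empty using (⊥-elim)
open import Data.Fin.Base using (Fin)
open import Data.Fin.Properties using (any?)
open import Data.Fin.Subset
open import Data.Fin.Subset.Properties
open import Data.Nat.Base using (ℕ; zero; suc; _+_; _^_; _⊔_; _≤_; _<_; z≤n; s≤s)
open import Data.Nat.Primality using (Prime)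
open import Data.Nat.Properties as ℕ using (module ≤-Reasoning)
open import Data.Product.Base using (∃; ∃-syntax; Σ-syntax; _×_; _,_; proj₁; proj₂)
open import Data.Sum.Base using (inj₁; inj₂; [_,_]′)
open import Data.Vec.Base using ([]; _∷_; here; there)
open import Function.Base using (_∘_)
open import Function.Bundles using (Inverse; _⇔_)
import Level
open import Relation.Binary.PropositionalEquality using (_≡_; _≢_; refl; sym; trans; cong; subst; setoid)
open import Relation.Nullary using (¬_; yes; no; does)
open import Relation.Nullary.Decidable using (_×-dec_; ¬?; map′)
open import Relation.Unary using (Decidable)

IsPrimePower : ℕ → Set
IsPrimePower q = ∃[ p ] ∃[ k ] Prime p × 1 ≤ k × q ≡ p ^ k

-- A field with exactly q elements up to its setoid equality; such a field is
-- unique up to isomorphism, so quantifying over all of them is fixing GF(q).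
record FiniteField (c ℓ : Level.Level) (q : ℕ) : Set (Level.suc (c Level.⊔ ℓ)) where
  field
    commutativeRing : CommutativeRing c ℓ
  open CommutativeRing commutativeRing public hiding (setoid)
  field
    1≉0         : ¬ (1# ≈ 0#)
    inverse     : ∀ x → ¬ (x ≈ 0#) → ∃[ y ] x * y ≈ 1#
    enumeration : Inverse (CommutativeRing.setoid commutativeRing) (setoid (Fin q))

-- A finite matroid on the ground set Fin n, given by its independent sets.
-- Decidability of independence is automatic classically.
record Matroid (n : ℕ) : Set₁ where
  field
    Indep   : Subset n → Set
    indep?  : Decidable Indep
    ⊥-indep : Indep ⊥
    ⊆-indep : ∀ {I J} → I ⊆ J → Indep J → Indep I
    augment : ∀ {I J} → Indep I → Indep J → ∣ I ∣ < ∣ J ∣ →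
              ∃[ x ] x ∈ J × x ∉ I × Indep (I ∪ ⁅ x ⁆)

maximum : ∀ {n} → (Subset n → ℕ) → ℕ
maximum {zero}  w = w []
maximum {suc n} w = maximum (w ∘ (inside ∷_)) ⊔ maximum (w ∘ (outside ∷_))

≤maximum : ∀ {n} (w : Subset n → ℕ) S → w S ≤ maximum w
≤maximum w []            = ℕ.≤-refl
≤maximum w (inside  ∷ S) = ℕ.≤-trans (≤maximum (w ∘ (inside ∷_)) S) (ℕ.m≤m⊔n _ _)
≤maximum w (outside ∷ S) = ℕ.≤-trans (≤maximum (w ∘ (outside ∷_)) S) (ℕ.m≤n⊔m _ _)

maximum-attained : ∀ {n} (w : Subset n → ℕ) → ∃[ S ] w S ≡ maximum w
maximum-attained {zero}  w = [] , refl
maximum-attained {suc n} w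
  with maximum-attained (w ∘ (inside ∷_)) | maximum-attained (w ∘ (outside ∷_))
     | ℕ.⊔-sel (maximum (w ∘ (inside ∷_))) (maximum (w ∘ (outside ∷_)))
... | S , p | _     | inj₁ eq = inside  ∷ S , trans p (sym eq)
... | _     | S , p | inj₂ eq = outside ∷ S , trans p (sym eq)

module _ {n : ℕ} (M : Matroid n) where
  open Matroid M

  -- The largest size of an independent set. The value 0 at dependent sets is
  -- harmless because ⊥ is independent.
  rank : ℕ
  rank = maximum λ I → if does (indep? I) then ∣ I ∣ else 0

  IsBasis : Subset n → Set
  IsBasis B = Indep B × (∀ I → B ⊂ I → ¬ Indep I)

  IsCircuit : Subset n → Set
  IsCircuit C = ¬ Indep C × (∀ D → D ⊂ C → Indep D)

  IsLoop : Fin n → Set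
  IsLoop e = IsCircuit ⁅ e ⁆

  Parallel : Fin n → Fin n → Set
  Parallel e f = e ≢ f × IsCircuit (⁅ e ⁆ ∪ ⁅ f ⁆)

  IsSimple : Set
  IsSimple = (∀ e → ¬ IsLoop e) × (∀ e f → ¬ Parallel e f)

  IsLoose : Fin n → Set
  IsLoose t = ∀ C → IsCircuit C → t ∈ C → rank ≤ ∣ C ∣

  -- Independence in the dual matroid: being contained in a dual basis, that
  -- is, in the complement of a basis.
  Coindep : Subset n → Set
  Coindep S = ∃[ B ] IsBasis B × S ⊆ ∁ B

private
  ∣p∪q∣≤∣p∣+∣q∣ : ∀ {n} (p q : Subset n) → ∣ p ∪ q ∣ ≤ ∣ p ∣ + ∣ q ∣
  ∣p∪q∣≤∣p∣+∣q∣ []            []            = z≤n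
  ∣p∪q∣≤∣p∣+∣q∣ (outside ∷ p) (outside ∷ q) = ∣p∪q∣≤∣p∣+∣q∣ p q
  ∣p∪q∣≤∣p∣+∣q∣ (outside ∷ p) (inside  ∷ q)
    rewrite ℕ.+-suc ∣ p ∣ ∣ q ∣ = s≤s (∣p∪q∣≤∣p∣+∣q∣ p q)
  ∣p∪q∣≤∣p∣+∣q∣ (inside  ∷ p) (outside ∷ q) = s≤s (∣p∪q∣≤∣p∣+∣q∣ p q)
  ∣p∪q∣≤∣p∣+∣q∣ (inside  ∷ p) (inside  ∷ q)
    rewrite ℕ.+-suc ∣ p ∣ ∣ q ∣ = s≤s (ℕ.m≤n⇒m≤1+n (∣p∪q∣≤∣p∣+∣q∣ p q))

  disjoint⇒∣p∣+∣q∣≤∣p∪q∣ : ∀ {n} (p q : Subset n) → (∀ {x} → x ∈ p → x ∉ q) →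
                           ∣ p ∣ + ∣ q ∣ ≤ ∣ p ∪ q ∣
  disjoint⇒∣p∣+∣q∣≤∣p∪q∣ []            []            d = z≤n
  disjoint⇒∣p∣+∣q∣≤∣p∪q∣ (outside ∷ p) (outside ∷ q) d =
    disjoint⇒∣p∣+∣q∣≤∣p∪q∣ p q (λ a b → d (there a) (there b))
  disjoint⇒∣p∣+∣q∣≤∣p∪q∣ (outside ∷ p) (inside  ∷ q) d
    rewrite ℕ.+-suc ∣ p ∣ ∣ q ∣ =
    s≤s (disjoint⇒∣p∣+∣q∣≤∣p∪q∣ p q (λ a b → d (there a) (there b)))
  disjoint⇒∣p∣+∣q∣≤∣p∪q∣ (inside  ∷ p) (outside ∷ q) d =
    s≤s (disjoint⇒∣p∣+∣q∣≤∣p∪q∣ p q (λ a b → d (there a) (there b)))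
  disjoint⇒∣p∣+∣q∣≤∣p∪q∣ (inside  ∷ p) (inside  ∷ q) d = ⊥-elim (d here here)

  ∪-lub : ∀ {n} (p q : Subset n) {r : Subset n} → p ⊆ r → q ⊆ r → p ∪ q ⊆ r
  ∪-lub p q p⊆r q⊆r = [ p⊆r , q⊆r ]′ ∘ x∈p∪q⁻ p q

  p⊂p∪⁅x⁆ : ∀ {n} {p : Subset n} {x} → x ∉ p → p ⊂ p ∪ ⁅ x ⁆
  p⊂p∪⁅x⁆ {p = p} {x} x∉p =
    p⊆p∪q ⁅ x ⁆ , x , q⊆p∪q p ⁅ x ⁆ (x∈⁅x⁆ x) , x∉p

  ⁅x⁆⊆p : ∀ {n} {p : Subset n} {x} → x ∈ p → ⁅ x ⁆ ⊆ p
  ⁅x⁆⊆p {p = p} x∈p y∈ = subst (_∈ p) (sym (x∈⁅y⁆⇒x≡y _ y∈)) x∈p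

module _ {n : ℕ} (M : Matroid n) where
  open Matroid M

  isBasis? : Decidable (IsBasis M)
  isBasis? B = indep? B ×-dec
    map′ (λ ¬∃ I B⊂I iI → ¬∃ (I , B⊂I , iI)) (λ ∀¬ (I , B⊂I , iI) → ∀¬ I B⊂I iI)
         (¬? (anySubset? λ I → (B ⊂? I) ×-dec indep? I))

  indep≤basis : ∀ {I B} → Indep I → IsBasis M B → ∣ I ∣ ≤ ∣ B ∣
  indep≤basis {I} {B} iI (iB , B-max) with ∣ I ∣ ℕ.≤? ∣ B ∣
  ... | yes ∣I∣≤∣B∣ = ∣I∣≤∣B∣
  ... | no  ∣I∣≰∣B∣ with augment iB iI (ℕ.≰⇒> ∣I∣≰∣B∣)
  ...   | x , _ , x∉B , iB′ = ⊥-elim (B-max _ (p⊂p∪⁅x⁆ x∉B) iB′)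

  private
    exchange : ∀ k {I J} → Indep I → Indep J → k + ∣ I ∣ ≡ ∣ J ∣ →
               ∃[ K ] Indep K × I ⊆ K × K ⊆ I ∪ J × ∣ J ∣ ≤ ∣ K ∣
    exchange zero {I} {J} iI iJ eq =
      I , iI , (λ x → x) , p⊆p∪q J , ℕ.≤-reflexive (sym eq)
    exchange (suc k) {I} {J} iI iJ eq
      with augment iI iJ (subst (∣ I ∣ <_) eq (s≤s (ℕ.m≤n+m ∣ I ∣ k)))
    ... | x , x∈J , x∉I , iI′
      with exchange k iI′ iJ (trans (cong (k +_) size) (trans (ℕ.+-suc k ∣ I ∣) eq))
      where
      size : ∣ I ∪ ⁅ x ⁆ ∣ ≡ suc ∣ I ∣
      size = ℕ.≤-antisym
        (ℕ.≤-trans (∣p∪q∣≤∣p∣+∣q∣ I ⁅ x ⁆)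
          (ℕ.≤-reflexive (trans (cong (∣ I ∣ +_) (∣⁅x⁆∣≡1 x)) (ℕ.+-comm ∣ I ∣ 1))))
        (p⊂q⇒∣p∣<∣q∣ (p⊂p∪⁅x⁆ x∉I))
    ... | K , iK , I′⊆K , K⊆I′∪J , ∣J∣≤∣K∣ =
      K , iK , I′⊆K ∘ p⊆p∪q ⁅ x ⁆ ,
      ∪-lub (I ∪ ⁅ x ⁆) J
        (∪-lub I ⁅ x ⁆ (p⊆p∪q J) (q⊆p∪q I J ∘ ⁅x⁆⊆p x∈J)) (q⊆p∪q I J) ∘ K⊆I′∪J ,
      ∣J∣≤∣K∣

  extendBy : ∀ {I B} → Indep I → IsBasis M B → ∃[ K ] IsBasis M K × I ⊆ K × K ⊆ I ∪ B
  extendBy {I} {B} iI bB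
    with exchange _ iI (proj₁ bB) (ℕ.m∸n+n≡m (indep≤basis iI bB))
  ... | K , iK , I⊆K , K⊆I∪B , ∣B∣≤∣K∣ =
    K ,
    (iK , λ L K⊂L iL →
      ℕ.<⇒≱ (p⊂q⇒∣p∣<∣q∣ K⊂L) (ℕ.≤-trans (indep≤basis iL bB) ∣B∣≤∣K∣)) ,
    I⊆K , K⊆I∪B

  private
    growBasis : ∀ k {I} → Indep I → n ≤ k + ∣ I ∣ → ∃ (IsBasis M)
    growBasis k {I} iI bound with anySubset? (λ J → (I ⊂? J) ×-dec indep? J)
    ... | no ¬∃ = I , iI , λ J I⊂J iJ → ¬∃ (J , I⊂J , iJ)
    growBasis zero    iI bound | yes (J , I⊂J , iJ) =
      ⊥-elim (ℕ.<⇒≱ (p⊂q⇒∣p∣<∣q∣ I⊂J) (ℕ.≤-trans (∣p∣≤n J) bound))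
    growBasis (suc k) {I} iI bound | yes (J , I⊂J , iJ) = growBasis k iJ (begin
      n               ≤⟨ bound ⟩
      suc (k + ∣ I ∣) ≡⟨ ℕ.+-suc k ∣ I ∣ ⟨
      k + suc ∣ I ∣   ≤⟨ ℕ.+-monoʳ-≤ k (p⊂q⇒∣p∣<∣q∣ I⊂J) ⟩
      k + ∣ J ∣       ∎)
      where open ≤-Reasoning

  basis : ∃ (IsBasis M)
  basis = growBasis n ⊥-indep (ℕ.m≤m+n n _)

  private
    coaugment : ∀ {S T} → Coindep M S → Coindep M T → ∣ S ∣ < ∣ T ∣ →
                ∃[ x ] x ∈ T × x ∉ S × Coindep M (S ∪ ⁅ x ⁆)
    coaugment {S} {T} (A , bA , S⊆∁A) (B , bB , T⊆∁B) ∣S∣<∣T∣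
      with extendBy (⊆-indep (p∩q⊆p B (∁ S)) (proj₁ bB)) bA
    ... | K , bK , B∩∁S⊆K , K⊆
      with any? (λ x → (x ∈? T) ×-dec (¬? (x ∈? S) ×-dec ¬? (x ∈? K)))
    ... | yes (x , x∈T , x∉S , x∉K) =
      x , x∈T , x∉S , K , bK , ∪-lub S ⁅ x ⁆ S⊆∁K (⁅x⁆⊆p (x∉p⇒x∈∁p x∉K))
      where
      S⊆∁K : S ⊆ ∁ K
      S⊆∁K x∈S = x∉p⇒x∈∁p λ x∈K → [ (λ x∈B∩∁S → x∈∁p⇒x∉p (p∩q⊆q B (∁ S) x∈B∩∁S) x∈S)
                                   , x∈∁p⇒x∉p (S⊆∁A x∈S) ]′ (x∈p∪q⁻ (B ∩ ∁ S) A (K⊆ x∈K))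
    ... | no ¬∃ = ⊥-elim (ℕ.<⇒≱ ∣S∣<∣T∣ (ℕ.+-cancelˡ-≤ ∣ B ∣ _ _ (begin
      ∣ B ∣ + ∣ T ∣ ≤⟨ disjoint⇒∣p∣+∣q∣≤∣p∪q∣ B T (λ x∈B x∈T → x∈∁p⇒x∉p (T⊆∁B x∈T) x∈B) ⟩
      ∣ B ∪ T ∣     ≤⟨ p⊆q⇒∣p∣≤∣q∣ (∪-lub B T B⊆K∪S T⊆K∪S) ⟩
      ∣ K ∪ S ∣     ≤⟨ ∣p∪q∣≤∣p∣+∣q∣ K S ⟩
      ∣ K ∣ + ∣ S ∣ ≤⟨ ℕ.+-monoˡ-≤ ∣ S ∣ (indep≤basis (proj₁ bK) bB) ⟩
      ∣ B ∣ + ∣ S ∣ ∎)))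
      where
      open ≤-Reasoning
      B⊆K∪S : B ⊆ K ∪ S
      B⊆K∪S {x} x∈B with x ∈? S
      ... | yes x∈S = q⊆p∪q K S x∈S
      ... | no  x∉S = p⊆p∪q S (B∩∁S⊆K (x∈p∩q⁺ (x∈B , x∉p⇒x∈∁p x∉S)))
      T⊆K∪S : T ⊆ K ∪ S
      T⊆K∪S {x} x∈T with x ∈? S | x ∈? K
      ... | yes x∈S | _       = q⊆p∪q K S x∈S
      ... | no  _   | yes x∈K = p⊆p∪q S x∈K
      ... | no  x∉S | no  x∉K = ⊥-elim (¬∃ (x , x∈T , x∉S , x∉K))

  dual : Matroid n
  dual = record
    { Indep   = Coindep M
    ; indep?  = λ S → anySubset? λ B → isBasis? B ×-dec (S ⊆? ∁ B)
    ; ⊥-indep = proj₁ basis , proj₂ basis , ⊆-min _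
    ; ⊆-indep = λ S⊆T (B , bB , T⊆∁B) → B , bB , T⊆∁B ∘ S⊆T
    ; augment = coaugment
    }

  indep≤rank : ∀ {I} → Indep I → ∣ I ∣ ≤ rank M
  indep≤rank {I} iI with indep? I in eq | ≤maximum (λ J → if does (indep? J) then ∣ J ∣ else 0) I
  ... | yes _  | p rewrite eq = p
  ... | no ¬iI | _ = ⊥-elim (¬iI iI)

  rank-attained : ∃[ I ] Indep I × ∣ I ∣ ≡ rank M
  rank-attained with maximum-attained (λ J → if does (indep? J) then ∣ J ∣ else 0)
  ... | I , eq with indep? I
  ...   | yes iI = I , iI , eq
  ...   | no  _  = ⊥ , ⊥-indep , trans (∣⊥∣≡0 n) eq

module _ {n : ℕ} (M : Matroid n) where

  IsCocircuit : Subset n → Set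
  IsCocircuit = IsCircuit (dual M)

  IsColoop : Fin n → Set
  IsColoop = IsLoop (dual M)

module _ {c ℓ : Level.Level} {q : ℕ} (F : FiniteField c ℓ q) where
  open FiniteField F using (Carrier; _≈_; 0#; _*_; +-rawMonoid)
  open RawMonoidDefs +-rawMonoid using (sum)

  -- The columns of A labelled by S are linearly independent as a family, so
  -- equal columns with distinct labels are dependent. A linear combination of
  -- them is given by a coefficient vector that vanishes outside S.
  ColumnsIndependent : ∀ {m n : ℕ} → (Fin m → Fin n → Carrier) → Subset n → Set (c Level.⊔ ℓ)
  ColumnsIndependent {n = n} A S =
    ∀ (a : Fin n → Carrier) → (∀ j → j ∉ S → a j ≈ 0#) → (∀ i → sum (λ j → a j * A i j) ≈ 0#) →
    ∀ j → a j ≈ 0#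

  RepresentableOver : ∀ {n : ℕ} → Matroid n → Set (c Level.⊔ ℓ)
  RepresentableOver {n} M = Σ[ m ∈ ℕ ] Σ[ A ∈ (Fin m → Fin n → Carrier) ]
    (∀ S → Matroid.Indep M S ⇔ ColumnsIndependent A S)

{-# OPTIONS --safe #-}

-- If {e, f} is not a cocircuit, then, as M has no coloops, some basis B avoids
-- both e and f. Put U = B ∪ {e, f}, so that |U| = r + 2. The set of linear
-- dependencies among the columns in U contains some a that is nonzero at e and
-- zero at f, and some b that is nonzero at f and zero at e. A nonzero
-- dependency supported in U has a circuit in its support; this circuit meets
-- {e, f} because B is independent, so by looseness the support has at least r
-- elements, and the dependency vanishes at no more than two elements of U. Now
-- every element of U is a zero of b or of a + λ b for some λ in GF(q). These
-- are q + 1 nonzero dependencies, whence r + 2 ≤ 2 (q + 1).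
module Submission where

open import Defs
open import Algebra.Bundles using (CommutativeRing)
import Algebra.Properties.Semiring.Sum as SemiringSum
open import Data.Bool.Properties using (T-≡)
open import Data.Fin.Base using (Fin; zero; suc)
import Data.Fin.Properties as Fin
open import Data.Fin.Subset using (Subset; inside; outside; ⊥; ∁; ⁅_⁆; _∪_; _∩_; _∈_; _∉_; _⊆_; _⊂_; ∣_∣)
open import Data.Fin.Subset.Induction using (Acc; acc; ⊂-wellFounded)
open import Data.Fin.Subset.Properties
open import Data.Nat.Base using (ℕ; zero; suc; _+_; _*_; _≤_; s≤s⁻¹)
import Data.Nat.Properties as ℕ
open import Data.Product.Base using (∃-syntax; _×_; _,_; proj₁; proj₂)
open import Data.Sum.Base using (_⊎_; inj₁; inj₂; [_,_]′)
open import Data.Vec.Base using ([]; _∷_; here; there; tabulate)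
open import Data.Vec.Properties using ([]=⇒lookup; lookup⇒[]=; lookup∘tabulate)
open import Function.Base using (_∘_; id)
open import Function.Bundles using (Equivalence; Inverse)
open import Level using (Level)
open import Relation.Binary.PropositionalEquality using (_≡_; _≢_; refl; sym; trans; cong; subst)
import Relation.Binary.Reasoning.Setoid as SetoidReasoning
open import Relation.Nullary using (¬_; Dec; yes; no; isYes; contradiction)
open import Relation.Nullary.Decidable using (_×-dec_; ¬?; map′; decidable-stable; toWitness; fromWitness)
open import Relation.Unary using (Pred; Decidable)

-- Subsets of a finite set and their sizes.

module _ {n : ℕ} {p} {P : Pred (Fin n) p} (P? : Decidable P) where

  comprehension : Subset n
  comprehension = tabulate (isYes ∘ P?)

  ∈-comprehension⁺ : ∀ {j} → P j → j ∈ comprehension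
  ∈-comprehension⁺ {j} pj = lookup⇒[]= j _
    (trans (lookup∘tabulate _ j) (Equivalence.to T-≡ (fromWitness {a? = P? j} pj)))

  ∈-comprehension⁻ : ∀ {j} → j ∈ comprehension → P j
  ∈-comprehension⁻ {j} j∈ = toWitness {a? = P? j}
    (Equivalence.from T-≡ (trans (sym (lookup∘tabulate _ j)) ([]=⇒lookup j∈)))

∣p∩q∣+∣p∩∁q∣≡∣p∣ : ∀ {n} (p q : Subset n) → ∣ p ∩ q ∣ + ∣ p ∩ ∁ q ∣ ≡ ∣ p ∣
∣p∩q∣+∣p∩∁q∣≡∣p∣ []            []            = refl
∣p∩q∣+∣p∩∁q∣≡∣p∣ (outside ∷ p) (_       ∷ q) = ∣p∩q∣+∣p∩∁q∣≡∣p∣ p q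
∣p∩q∣+∣p∩∁q∣≡∣p∣ (inside  ∷ p) (inside  ∷ q) = cong suc (∣p∩q∣+∣p∩∁q∣≡∣p∣ p q)
∣p∩q∣+∣p∩∁q∣≡∣p∣ (inside  ∷ p) (outside ∷ q) =
  trans (ℕ.+-suc _ _) (cong suc (∣p∩q∣+∣p∩∁q∣≡∣p∣ p q))

x∉p⇒∣p∪⁅x⁆∣≡1+∣p∣ : ∀ {n} {x} (p : Subset n) → x ∉ p → ∣ p ∪ ⁅ x ⁆ ∣ ≡ suc ∣ p ∣
x∉p⇒∣p∪⁅x⁆∣≡1+∣p∣ {x = zero}  (inside  ∷ p) x∉p = contradiction here x∉p
x∉p⇒∣p∪⁅x⁆∣≡1+∣p∣ {x = zero}  (outside ∷ p) x∉p = cong (suc ∘ ∣_∣) (∪-identityʳ p)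
x∉p⇒∣p∪⁅x⁆∣≡1+∣p∣ {x = suc _} (inside  ∷ p) x∉p = cong suc (x∉p⇒∣p∪⁅x⁆∣≡1+∣p∣ p (x∉p ∘ there))
x∉p⇒∣p∪⁅x⁆∣≡1+∣p∣ {x = suc _} (outside ∷ p) x∉p = x∉p⇒∣p∪⁅x⁆∣≡1+∣p∣ p (x∉p ∘ there)

-- Split off `Z zero`: the other sets cover what remains of `U`. Only the part of each `Z i` inside
-- `U` is bounded, since the zero sets to which this is applied contain everything outside `U`.
∣cover∣≤ : ∀ {n} m k (U : Subset n) (Z : Fin k → Subset n) →
           (∀ {j} → j ∈ U → ∃[ i ] j ∈ Z i) → (∀ i → ∣ U ∩ Z i ∣ ≤ m) → ∣ U ∣ ≤ k * m
∣cover∣≤ {n} m zero U Z covers small =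
  ℕ.≤-trans (p⊆q⇒∣p∣≤∣q∣ {q = ⊥} (λ j∈U → contradiction (proj₁ (covers j∈U)) λ ()))
            (ℕ.≤-reflexive (∣⊥∣≡0 n))
∣cover∣≤ m (suc k) U Z covers small = begin
  ∣ U ∣                              ≡⟨ ∣p∩q∣+∣p∩∁q∣≡∣p∣ U (Z zero) ⟨
  ∣ U ∩ Z zero ∣ + ∣ U ∩ ∁ (Z zero) ∣ ≤⟨ ℕ.+-mono-≤ (small zero) rest ⟩
  m + k * m                          ∎
  where
  open ℕ.≤-Reasoning
  V = U ∩ ∁ (Z zero)

  V-covers : ∀ {j} → j ∈ V → ∃[ i ] j ∈ Z (suc i)
  V-covers j∈V with covers (p∩q⊆p U _ j∈V)
  ... | zero  , j∈Z = contradiction j∈Z (x∈∁p⇒x∉p (p∩q⊆q U _ j∈V))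
  ... | suc i , j∈Z = i , j∈Z

  rest : ∣ V ∣ ≤ k * m
  rest = ∣cover∣≤ m k V (Z ∘ suc) V-covers λ i → ℕ.≤-trans
    (p⊆q⇒∣p∣≤∣q∣ (λ j∈ → x∈p∩q⁺ (p∩q⊆p U _ (p∩q⊆p V _ j∈) , p∩q⊆q V _ j∈)))
    (small (suc i))

-- Circuits, bases and loose elements.

module _ {n : ℕ} (M : Matroid n) where
  open Matroid M

  -- Descent along `⊂`: a dependent set without a dependent proper subset is itself a circuit.
  dependent⇒∃circuit : ∀ {S} → ¬ Indep S → ∃[ C ] IsCircuit M C × C ⊆ S
  dependent⇒∃circuit {S} = go (⊂-wellFounded S)
    where
    go : ∀ {S} → Acc _⊂_ S → ¬ Indep S → ∃[ C ] IsCircuit M C × C ⊆ S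
    go {S} (acc rec) ¬iS with anySubset? (λ D → (D ⊂? S) ×-dec ¬? (indep? D))
    ... | no ¬∃ = S , (¬iS , λ D D⊂S → decidable-stable (indep? D) λ ¬iD → ¬∃ (D , D⊂S , ¬iD)) , id
    ... | yes (D , D⊂S , ¬iD) with go (rec D⊂S) ¬iD
    ...   | C , cC , C⊆D = C , cC , proj₁ D⊂S ∘ C⊆D

  ∣basis∣≡rank : ∀ {B} → IsBasis M B → ∣ B ∣ ≡ rank M
  ∣basis∣≡rank bB with rank-attained M
  ... | I , iI , ∣I∣≡r = ℕ.≤-antisym (indep≤rank M (proj₁ bB))
    (ℕ.≤-trans (ℕ.≤-reflexive (sym ∣I∣≡r)) (indep≤basis M iI bB))

  basis∪⁅x⁆-dependent : ∀ {B x} → IsBasis M B → x ∉ B → ¬ Indep (B ∪ ⁅ x ⁆)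
  basis∪⁅x⁆-dependent {B} {x} (_ , B-max) x∉B =
    B-max _ (p⊆p∪q _ , x , q⊆p∪q B _ (x∈⁅x⁆ x) , x∉B)

  -- A circuit inside `S` that missed both `e` and `f` would lie in the independent set `B`. So it
  -- contains a loose element and has at least `rank M` elements.
  loose-dependent-size : ∀ {B S e f} → Indep B → IsLoose M e → IsLoose M f →
    S ⊆ (B ∪ ⁅ e ⁆) ∪ ⁅ f ⁆ → ¬ Indep S → rank M ≤ ∣ S ∣
  loose-dependent-size {B} {S} {e} {f} iB le lf S⊆ ¬iS with dependent⇒∃circuit ¬iS
  ... | C , cC , C⊆S with e ∈? C | f ∈? C
  ...   | yes e∈C | _       = ℕ.≤-trans (le C cC e∈C) (p⊆q⇒∣p∣≤∣q∣ C⊆S)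
  ...   | no  _   | yes f∈C = ℕ.≤-trans (lf C cC f∈C) (p⊆q⇒∣p∣≤∣q∣ C⊆S)
  ...   | no  e∉C | no  f∉C = contradiction (⊆-indep C⊆B iB) (proj₁ cC)
    where
    avoids : ∀ {x y} → x ∉ C → y ∈ C → y ∉ ⁅ x ⁆
    avoids x∉C y∈C y∈⁅x⁆ = x∉C (subst (_∈ C) (x∈⁅y⁆⇒x≡y _ y∈⁅x⁆) y∈C)

    C⊆B : C ⊆ B
    C⊆B y∈C = [ [ id , (λ y∈e → contradiction y∈e (avoids e∉C y∈C)) ]′ ∘ x∈p∪q⁻ B _
              , (λ y∈f → contradiction y∈f (avoids f∉C y∈C)) ]′ (x∈p∪q⁻ (B ∪ ⁅ e ⁆) _ (S⊆ (C⊆S y∈C)))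

  ¬loop⇒indep : ∀ {x} → ¬ IsLoop M x → Indep ⁅ x ⁆
  ¬loop⇒indep {x} ¬loop = decidable-stable (indep? _) λ ¬ix → ¬loop (¬ix , λ D (D⊆ , y , y∈ , y∉D) →
    ⊆-indep (λ {z} z∈D → contradiction
      (subst (_∈ D) (trans (x∈⁅y⁆⇒x≡y x (D⊆ z∈D)) (sym (x∈⁅y⁆⇒x≡y x y∈))) z∈D) y∉D) ⊥-indep)

  -- A proper subset of the pair misses one of its elements, so it lies in the singleton of the
  -- other, which is independent. Applied to the dual matroid, this yields the cocircuit.
  dependent-pair⇒circuit : ∀ {x y} → ¬ IsLoop M x → ¬ IsLoop M y →
    ¬ Indep (⁅ x ⁆ ∪ ⁅ y ⁆) → IsCircuit M (⁅ x ⁆ ∪ ⁅ y ⁆)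
  dependent-pair⇒circuit {x} {y} ¬lx ¬ly ¬ixy = ¬ixy , proper-indep
    where
    proper-indep : ∀ D → D ⊂ ⁅ x ⁆ ∪ ⁅ y ⁆ → Indep D
    proper-indep D (D⊆ , z , z∈ , z∉D) with x∈p∪q⁻ ⁅ x ⁆ ⁅ y ⁆ z∈
    ... | inj₁ z∈x = ⊆-indep (λ {w} w∈D → [ (λ w∈x → contradiction
            (subst (_∈ D) (trans (x∈⁅y⁆⇒x≡y x w∈x) (sym (x∈⁅y⁆⇒x≡y x z∈x))) w∈D) z∉D)
          , id ]′ (x∈p∪q⁻ ⁅ x ⁆ ⁅ y ⁆ (D⊆ w∈D))) (¬loop⇒indep ¬ly)
    ... | inj₂ z∈y = ⊆-indep (λ {w} w∈D → [ id , (λ w∈y → contradiction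
            (subst (_∈ D) (trans (x∈⁅y⁆⇒x≡y y w∈y) (sym (x∈⁅y⁆⇒x≡y y z∈y))) w∈D) z∉D)
          ]′ (x∈p∪q⁻ ⁅ x ⁆ ⁅ y ⁆ (D⊆ w∈D))) (¬loop⇒indep ¬lx)

-- Linear dependencies among columns over the finite field.

module _ {c ℓ : Level} {q : ℕ} (F : FiniteField c ℓ q) where
  private
    module F = FiniteField F
    module Enum = Inverse F.enumeration
    module ≈-Reasoning = SetoidReasoning (CommutativeRing.setoid F.commutativeRing)
  open F using (Carrier; _≈_; 0#)
  open SemiringSum F.semiring using (sum; sum-cong-≋; ∑-distrib-+; *-distribˡ-sum)

  infix 4 _≈?_
  _≈?_ : ∀ x y → Dec (x ≈ y)
  x ≈? y = map′ (λ eq → F.trans (F.sym (Enum.strictlyInverseʳ x))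
                          (F.trans (Enum.from-cong eq) (Enum.strictlyInverseʳ y)))
                Enum.to-cong (Enum.to x Fin.≟ Enum.to y)

  -- The solution is `- x * y⁻¹`. It is returned as an index into the enumeration of the field
  -- because the members of the pencil below are numbered that way.
  y≉0⇒∃x+λy≈0 : ∀ x {y} → ¬ y ≈ 0# → ∃[ i ] x F.+ Enum.from i F.* y ≈ 0#
  y≉0⇒∃x+λy≈0 x {y} y≉0 with F.inverse y y≉0
  ... | y⁻¹ , yy⁻¹≈1 = Enum.to λ′ , (begin
    x F.+ Enum.from (Enum.to λ′) F.* y ≈⟨ F.+-congˡ (F.*-congʳ (Enum.strictlyInverseʳ λ′)) ⟩
    x F.+ (F.- x F.* y⁻¹) F.* y        ≈⟨ F.+-congˡ (F.*-assoc _ _ _) ⟩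
    x F.+ F.- x F.* (y⁻¹ F.* y)        ≈⟨ F.+-congˡ (F.*-congˡ (F.trans (F.*-comm _ _) yy⁻¹≈1)) ⟩
    x F.+ F.- x F.* F.1#               ≈⟨ F.+-congˡ (F.*-identityʳ _) ⟩
    x F.+ F.- x                        ≈⟨ F.-‿inverseʳ x ⟩
    0#                                 ∎)
    where
    open ≈-Reasoning
    λ′ = F.- x F.* y⁻¹

  module _ {n : ℕ} where

    zeros : (Fin n → Carrier) → Subset n
    zeros d = comprehension λ j → d j ≈? 0#

    module _ {m : ℕ} (A : Fin m → Fin n → Carrier) where

      IsDependency : (Fin n → Carrier) → Set ℓ
      IsDependency d = ∀ i → sum (λ j → d j F.* A i j) ≈ 0#

      combination-isDependency : ∀ {a b} x → IsDependency a → IsDependency b →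
        IsDependency λ j → a j F.+ x F.* b j
      combination-isDependency {a} {b} x a-dep b-dep i = begin
        sum (λ j → (a j F.+ x F.* b j) F.* A i j)
          ≈⟨ sum-cong-≋ {n} (λ j → F.trans (F.distribʳ (A i j) (a j) _) (F.+-congˡ (F.*-assoc x (b j) (A i j)))) ⟩
        sum (λ j → a j F.* A i j F.+ x F.* (b j F.* A i j))
          ≈⟨ ∑-distrib-+ (λ j → a j F.* A i j) (λ j → x F.* (b j F.* A i j)) ⟩
        sum (λ j → a j F.* A i j) F.+ sum (λ j → x F.* (b j F.* A i j))
          ≈⟨ F.+-cong (a-dep i) (F.sym (*-distribˡ-sum x (λ j → b j F.* A i j))) ⟩
        0# F.+ x F.* sum (λ j → b j F.* A i j)
          ≈⟨ F.trans (F.+-identityˡ _) (F.*-congˡ (b-dep i)) ⟩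
        x F.* 0#
          ≈⟨ F.zeroʳ x ⟩
        0# ∎
        where open ≈-Reasoning

      -- The double negation spares an exhaustive search through GF(q)ⁿ.
      dependency-through : ∀ {S x} → ColumnsIndependent F A S → ¬ ColumnsIndependent F A (S ∪ ⁅ x ⁆) →
        ¬ ¬ (∃[ a ] (∀ j → j ∉ S ∪ ⁅ x ⁆ → a j ≈ 0#) × IsDependency a × ¬ a x ≈ 0#)
      dependency-through {S} {x} iS ¬iSx ¬∃ = ¬iSx λ a off a-dep →
        iS a (off-S a off (decidable-stable (a x ≈? 0#) λ ax≉0 → ¬∃ (a , off , a-dep , ax≉0))) a-dep
        where
        off-S : ∀ a → (∀ j → j ∉ S ∪ ⁅ x ⁆ → a j ≈ 0#) → a x ≈ 0# → ∀ j → j ∉ S → a j ≈ 0#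
        off-S a off ax≈0 j j∉S with j Fin.≟ x
        ... | yes refl = ax≈0
        ... | no  j≢x  = off j ([ j∉S , j≢x ∘ x∈⁅y⁆⇒x≡y x ]′ ∘ x∈p∪q⁻ S _)

  -- Counting zeros in a pencil of dependencies.

  module _ {n : ℕ} (M : Matroid n) (repr : RepresentableOver F M) {B : Subset n} {e f : Fin n}
           (bB : IsBasis M B) (e∉B : e ∉ B) (f∉B : f ∉ B) (e≢f : e ≢ f)
           (le : IsLoose M e) (lf : IsLoose M f) where
    open Matroid M
    private
      A = proj₁ (proj₂ repr)
      module Repr S = Equivalence (proj₂ (proj₂ repr) S)

      U : Subset n
      U = (B ∪ ⁅ e ⁆) ∪ ⁅ f ⁆

      f∉B∪e : f ∉ B ∪ ⁅ e ⁆
      f∉B∪e = [ f∉B , e≢f ∘ sym ∘ x∈⁅y⁆⇒x≡y e ]′ ∘ x∈p∪q⁻ B _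

      e∉B∪f : e ∉ B ∪ ⁅ f ⁆
      e∉B∪f = [ e∉B , e≢f ∘ x∈⁅y⁆⇒x≡y f ]′ ∘ x∈p∪q⁻ B _

      ∣U∣≡2+r : ∣ U ∣ ≡ 2 + rank M
      ∣U∣≡2+r = trans (x∉p⇒∣p∪⁅x⁆∣≡1+∣p∣ (B ∪ ⁅ e ⁆) f∉B∪e)
        (cong suc (trans (x∉p⇒∣p∪⁅x⁆∣≡1+∣p∣ B e∉B) (cong suc (∣basis∣≡rank M bB))))

      B∪f⊆U : B ∪ ⁅ f ⁆ ⊆ U
      B∪f⊆U = [ p⊆p∪q ⁅ f ⁆ ∘ p⊆p∪q ⁅ e ⁆ , q⊆p∪q (B ∪ ⁅ e ⁆) ⁅ f ⁆ ]′ ∘ x∈p∪q⁻ B _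

    -- As `d` is nonzero at `x`, its support is a dependent subset of `U` and has at least `rank M`
    -- of the `2 + rank M` elements.
    ∣zeros∣≤2 : ∀ d → (∀ j → j ∉ U → d j ≈ 0#) → IsDependency A d → ∀ {x} → ¬ d x ≈ 0# →
                ∣ U ∩ zeros d ∣ ≤ 2
    ∣zeros∣≤2 d off d-dep {x} dx≉0 = ℕ.+-cancelʳ-≤ (rank M) _ 2 (begin
      ∣ U ∩ zeros d ∣ + rank M                ≤⟨ ℕ.+-monoʳ-≤ ∣ U ∩ zeros d ∣ r≤∣supp∣ ⟩
      ∣ U ∩ zeros d ∣ + ∣ U ∩ ∁ (zeros d) ∣ ≡⟨ ∣p∩q∣+∣p∩∁q∣≡∣p∣ U (zeros d) ⟩
      ∣ U ∣                                   ≡⟨ ∣U∣≡2+r ⟩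
      2 + rank M                              ∎)
      where
      open ℕ.≤-Reasoning
      supp-dependent : ¬ Indep (U ∩ ∁ (zeros d))
      supp-dependent iS = dx≉0 (Repr.to _ iS d off-supp d-dep x)
        where
        off-supp : ∀ j → j ∉ U ∩ ∁ (zeros d) → d j ≈ 0#
        off-supp j j∉ with j ∈? U | d j ≈? 0#
        ... | no  j∉U | _        = off j j∉U
        ... | yes _   | yes dj≈0 = dj≈0
        ... | yes j∈U | no  dj≉0 = contradiction
          (x∈p∩q⁺ (j∈U , x∉p⇒x∈∁p (dj≉0 ∘ ∈-comprehension⁻ λ j → d j ≈? 0#))) j∉

      r≤∣supp∣ : rank M ≤ ∣ U ∩ ∁ (zeros d) ∣
      r≤∣supp∣ = loose-dependent-size M (proj₁ bB) le lf (p∩q⊆p U _) supp-dependent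

    pencil-bound : ∀ a b → (∀ j → j ∉ B ∪ ⁅ e ⁆ → a j ≈ 0#) → IsDependency A a → ¬ a e ≈ 0# →
                   (∀ j → j ∉ B ∪ ⁅ f ⁆ → b j ≈ 0#) → IsDependency A b → ¬ b f ≈ 0# →
                   rank M ≤ 2 * q
    pencil-bound a b a-off a-dep ae≉0 b-off b-dep bf≉0 =
      -- `suc q * 2` unfolds to `2 + q * 2`, so removing two successors from both sides gives the
      -- bound.
      ℕ.≤-trans (s≤s⁻¹ (s≤s⁻¹ 2+r≤)) (ℕ.≤-reflexive (ℕ.*-comm q 2))
      where
      pencil : Fin (suc q) → Fin n → Carrier
      -- The member at infinity: it accounts for the zeros of `b`, where no combination `a + λ b`
      -- need vanish.
      pencil zero    = b
      pencil (suc i) = λ j → a j F.+ Enum.from i F.* b j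

      a+λb≈a : ∀ i {j} → b j ≈ 0# → pencil (suc i) j ≈ a j
      a+λb≈a i bj≈0 = F.trans (F.+-congˡ (F.trans (F.*-congˡ bj≈0) (F.zeroʳ _))) (F.+-identityʳ _)

      few-zeros : ∀ i → ∣ U ∩ zeros (pencil i) ∣ ≤ 2
      few-zeros zero    = ∣zeros∣≤2 b (λ j j∉U → b-off j (j∉U ∘ B∪f⊆U)) b-dep bf≉0
      few-zeros (suc i) = ∣zeros∣≤2 (pencil (suc i))
        (λ j j∉U → F.trans (a+λb≈a i (b-off j (j∉U ∘ B∪f⊆U))) (a-off j (j∉U ∘ p⊆p∪q _)))
        (combination-isDependency A (Enum.from i) a-dep b-dep)
        -- At `e` the vector `b` vanishes, so every `a + λ b` keeps the nonzero value of `a` there.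
        (ae≉0 ∘ F.trans (F.sym (a+λb≈a i (b-off e e∉B∪f))))

      covers : ∀ {j} → j ∈ U → ∃[ i ] j ∈ zeros (pencil i)
      covers {j} _ with b j ≈? 0#
      ... | yes bj≈0 = zero , ∈-comprehension⁺ (λ j → b j ≈? 0#) bj≈0
      ... | no  bj≉0 with y≉0⇒∃x+λy≈0 (a j) bj≉0
      ...   | i , eq = suc i , ∈-comprehension⁺ (λ j → pencil (suc i) j ≈? 0#) eq

      2+r≤ : 2 + rank M ≤ suc q * 2
      2+r≤ = subst (_≤ suc q * 2) ∣U∣≡2+r (∣cover∣≤ 2 (suc q) U (zeros ∘ pencil) covers few-zeros)

    loose-pair-bound : rank M ≤ 2 * q
    -- The bound is decidable, hence stable under double negation, so it suffices that `a` and `b`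
    -- exist up to double negation.
    loose-pair-bound = decidable-stable (rank M ℕ.≤? 2 * q) λ r≰2q →
      dependency-through A iB (through e∉B) λ (a , a-off , a-dep , ae≉0) →
      dependency-through A iB (through f∉B) λ (b , b-off , b-dep , bf≉0) →
      r≰2q (pencil-bound a b a-off a-dep ae≉0 b-off b-dep bf≉0)
      where
      iB : ColumnsIndependent F A B
      iB = Repr.to B (proj₁ bB)

      through : ∀ {x} → x ∉ B → ¬ ColumnsIndependent F A (B ∪ ⁅ x ⁆)
      through x∉B = basis∪⁅x⁆-dependent M bB x∉B ∘ Repr.from _

theorem4p1 : ∀ {c ℓ : Level} (q : ℕ) → IsPrimePower q → (F : FiniteField c ℓ q) →
    ∀ (n : ℕ) (M : Matroid n) → IsSimple M → RepresentableOver F M →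
    (∀ g → ¬ IsColoop M g) →
    ∀ (e f : Fin n) → e ≢ f → IsLoose M e → IsLoose M f →
    rank M ≤ 2 * q ⊎ IsCocircuit M (⁅ e ⁆ ∪ ⁅ f ⁆)
theorem4p1 q _ F n M _ repr no-coloops e f e≢f le lf
  with Matroid.indep? (dual M) (⁅ e ⁆ ∪ ⁅ f ⁆)
... | no  ¬coindep = inj₂ (dependent-pair⇒circuit (dual M) (no-coloops e) (no-coloops f) ¬coindep)
-- Coindependence of the pair supplies a basis that avoids both `e` and `f`.
... | yes (B , bB , ef⊆∁B) = inj₁ (loose-pair-bound F M repr bB
  (x∈∁p⇒x∉p (ef⊆∁B (p⊆p∪q ⁅ f ⁆ (x∈⁅x⁆ e)))) (x∈∁p⇒x∉p (ef⊆∁B (q⊆p∪q ⁅ e ⁆ ⁅ f ⁆ (x∈⁅x⁆ f)))) e≢f le lf)
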